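{- For all integers $k\ge0$, \[ T_k(t,q)=\sum_{\nu \in \mathcal{SOP}(k)} (-1)^{\mathrm{diag}(\nu)+\left\lfloor \mathrm{mark}(\nu)/2\right\rfloor}\, t^{\mathrm{mark}(\nu)}\, q^{|\nu|}. \]
   Context: The polynomials $T_k(t,q)$ in the indeterminates $t,q$ are defined by $T_0(t,q)=1$ and, for $k\ge1$, \[ T_k(t,q) = T_{k-1}(t,q) + (1+t)(-q)^{k^2} + (1-t^2) \sum_{i=1}^{k-1} (-q)^{k^2-i^2}\, T_{i-1}(t,q). \] Partitions are identified with their Ferrers diagrams: left-justified rows of cells, the $i$-th row from the top having $\lambda_i$ cells; the $(i,j)$-cell is the cell in row $i$ and column $j$. An inner corner of a partition $\lambda$ is a cell $c\in\lambda$ such that $\lambda\setminus\{c\}$ is a partition. An overpartition is a partition in which each inner corner may or may not be marked. Its conjugate is obtained by transposing the underlying partition, the $(i,j)$-cell being marked in the conjugate if and only if the $(j,i)$-cell is marked in the original. A self-conjugate overpartition is one equal to its conjugate. $\mathcal{SOP}(k)$ is the set of self-conjugate overpartitions whose underlying partition is contained in the $k\times k$ box (at most $k$ parts, each at most $k$). For an overpartition $\nu$: $|\nu|$ is the number of cells, $\mathrm{diag}(\nu)$ is the number of cells of the form $(i,i)$ in $\nu$, and $\mathrm{mark}(\nu)$ is the number of marked cells. -}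

module Defs where

open import Algebra.Bundles.Raw using (RawRing)
import Algebra.Definitions.RawSemiring as RawSemiringDefinitions
open import Data.Bool.Base using (Bool; T; if_then_else_; _∧_)
open import Data.Integer.Base as ℤ using (ℤ; 0ℤ; 1ℤ)
open import Data.List.Base
  using (List; []; _∷_; _++_; map; foldr; filter; filterᵇ; length; concatMap;
         cartesianProductWith; upTo; applyUpTo)
open import Data.List.Properties using (filter-accept; filter-reject)
open import Data.List.Relation.Unary.All as All using (All; []; _∷_)
import Data.List.Relation.Unary.All.Properties as All
open import Data.List.Relation.Unary.Linked as Linked using (Linked; []; [-]; _∷_)
import Data.List.Relation.Unary.Linked.Properties as Linked
import Data.List.Membership.Setoid as Membership
import Data.List.Relation.Unary.Unique.Setoid as Unique
open import Data.Nat.Base as ℕ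
  using (ℕ; zero; suc; _∸_; _≤_; _<_; _≥_; _>_; z≤n; s≤s; z<s)
open import Data.Nat.Properties as ℕ using (_<?_; _≟_)
open import Data.Product.Base using (∃; _×_; _,_; proj₁; proj₂; swap)
open import Function.Base using (_∘_)
open import Function.Bundles using (_⇔_)
open import Level using (0ℓ)
open import Relation.Binary.Bundles using (Setoid)
open import Relation.Binary.PropositionalEquality
  using (_≡_; _≢_; refl; sym; trans; cong; subst)
open import Relation.Nullary.Decidable using (Dec; yes; no; does)
open import Relation.Nullary.Negation using (¬_; contradiction)
open import Relation.Unary using (Pred; _≐_; _∖_; ｛_｝) renaming (_∈_ to _∈ₚ_)

------------------------------------------------------------------------
-- The polynomial ring ℤ[t,q]

-- A polynomial is a formal sum of terms c tⁱ qʲ in any order and possibly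
-- with repetitions; equality of polynomials is equality of all coefficients.

record Term : Set where
  constructor term
  field
    scalar : ℤ
    t-deg  : ℕ
    q-deg  : ℕ

Polynomial : Set
Polynomial = List Term

coeff : Polynomial → ℕ → ℕ → ℤ
coeff []               a b = 0ℤ
coeff (term c i j ∷ p) a b =
  (if does (i ≟ a) ∧ does (j ≟ b) then c else 0ℤ) ℤ.+ coeff p a b

negTerm : Term → Term
negTerm (term c i j) = term (ℤ.- c) i j

mulTerm : Term → Term → Term
mulTerm (term c i j) (term d k l) = term (c ℤ.* d) (i ℕ.+ k) (j ℕ.+ l)

ℤ[t,q] : RawRing 0ℓ 0ℓ
ℤ[t,q] = record
  { Carrier = Polynomial
  ; _≈_     = λ p r → ∀ a b → coeff p a b ≡ coeff r a b
  ; _+_     = _++_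
  ; _*_     = cartesianProductWith mulTerm
  ; -_      = map negTerm
  ; 0#      = []
  ; 1#      = term 1ℤ 0 0 ∷ []
  }

open RawRing ℤ[t,q] public using (_≈_; _+_; _*_; -_; 0#; 1#; rawSemiring)
open RawSemiringDefinitions rawSemiring public using (_^_)

infixl 6 _-_
_-_ : Polynomial → Polynomial → Polynomial
p - r = p + - r

t q : Polynomial
t = term 1ℤ 1 0 ∷ []
q = term 1ℤ 0 1 ∷ []

-- Sum of f over the entries of a list.
∑ : {A : Set} → List A → (A → Polynomial) → Polynomial
∑ xs f = foldr (λ x p → f x + p) 0# xs

infix 3 ∑
syntax ∑ xs (λ x → p) = ∑[ x ∈ xs ] p

------------------------------------------------------------------------
-- The polynomials T_k

-- partialSum k n = Σ_{i=1}^{n} (-q)^(k² - i²) T_{i-1}; the recurrence uses it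
-- only with n = k - 1, so the truncated subtraction is exact.

mutual
  T[_] : ℕ → Polynomial
  T[ zero ]      = 1#
  T[ k@(suc n) ] =
    T[ n ] + (1# + t) * (- q) ^ (k ℕ.* k) + (1# - t ^ 2) * partialSum k n

  partialSum : ℕ → ℕ → Polynomial
  partialSum k zero        = 0#
  partialSum k i@(suc i-1) =
    partialSum k i-1 + (- q) ^ (k ℕ.* k ∸ i ℕ.* i) * T[ i-1 ]

------------------------------------------------------------------------
-- Partitions and their Ferrers diagrams

record Partition : Set where
  field
    parts      : List ℕ
    decreasing : Linked _≥_ parts
    positive   : All (_> 0) parts

open Partition public

-- Rows and columns are numbered from 0; rows beyond the last part are empty.

Cell : Set
Cell = ℕ × ℕ

rowLength : List ℕ → ℕ → ℕ
rowLength []       i       = 0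
rowLength (x ∷ xs) zero    = x
rowLength (x ∷ xs) (suc i) = rowLength xs i

diagram : Partition → Pred Cell 0ℓ
diagram λ′ (i , j) = j < rowLength (parts λ′) i

cells : Partition → List Cell
cells λ′ =
  concatMap (λ i → map (i ,_) (upTo (rowLength (parts λ′) i)))
            (upTo (length (parts λ′)))

InnerCorner : Partition → Pred Cell 0ℓ
InnerCorner λ′ c =
  c ∈ₚ diagram λ′ × ∃ λ μ → diagram μ ≐ (diagram λ′ ∖ ｛ c ｝)

------------------------------------------------------------------------
-- Conjugate partition

columnLength : List ℕ → ℕ → ℕ
columnLength xs j = length (filter (j <?_) xs)

conjugateParts : List ℕ → List ℕ
conjugateParts xs = applyUpTo (columnLength xs) (rowLength xs 0)

module ConjugateLemmas where

  accept : ∀ {x j} xs → j < x →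
           columnLength (x ∷ xs) j ≡ suc (columnLength xs j)
  accept {j = j} xs j<x = cong length (filter-accept (j <?_) {xs = xs} j<x)

  reject : ∀ {x j} xs → ¬ j < x →
           columnLength (x ∷ xs) j ≡ columnLength xs j
  reject {j = j} xs j≮x = cong length (filter-reject (j <?_) {xs = xs} j≮x)

  columnLength-mono : ∀ xs j → columnLength xs (suc j) ≤ columnLength xs j
  columnLength-mono []       j = z≤n
  columnLength-mono (x ∷ xs) j = helper (suc j <? x) (j <? x)
    where
    open ℕ.≤-Reasoning
    helper : Dec (suc j < x) → Dec (j < x) →
             columnLength (x ∷ xs) (suc j) ≤ columnLength (x ∷ xs) j
    helper (yes 1+j<x) _ = begin
      columnLength (x ∷ xs) (suc j) ≡⟨ accept xs 1+j<x ⟩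
      suc (columnLength xs (suc j)) ≤⟨ s≤s (columnLength-mono xs j) ⟩
      suc (columnLength xs j)       ≡⟨ accept xs (ℕ.<-trans (ℕ.n<1+n j) 1+j<x) ⟨
      columnLength (x ∷ xs) j       ∎
    helper (no 1+j≮x) (yes j<x) = begin
      columnLength (x ∷ xs) (suc j) ≡⟨ reject xs 1+j≮x ⟩
      columnLength xs (suc j)       ≤⟨ ℕ.m≤n⇒m≤1+n (columnLength-mono xs j) ⟩
      suc (columnLength xs j)       ≡⟨ accept xs j<x ⟨
      columnLength (x ∷ xs) j       ∎
    helper (no 1+j≮x) (no j≮x) = begin
      columnLength (x ∷ xs) (suc j) ≡⟨ reject xs 1+j≮x ⟩
      columnLength xs (suc j)       ≤⟨ columnLength-mono xs j ⟩
      columnLength xs j             ≡⟨ reject xs j≮x ⟨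
      columnLength (x ∷ xs) j       ∎

  columnLength-pos : ∀ xs {j} → j < rowLength xs 0 → columnLength xs j > 0
  columnLength-pos (x ∷ xs) j<x = subst (_> 0) (sym (accept xs j<x)) z<s

  rowLength-tail : ∀ {x xs} → Linked _≥_ (x ∷ xs) → rowLength xs 0 ≤ x
  rowLength-tail [-]       = z≤n
  rowLength-tail (x≥y ∷ _) = x≥y

  columnLength-zero : ∀ {xs} → Linked _≥_ xs → ∀ {j} →
                      ¬ j < rowLength xs 0 → columnLength xs j ≡ 0
  columnLength-zero {[]}     l j≮ = refl
  columnLength-zero {x ∷ xs} l j≮ =
    trans (reject xs j≮)
          (columnLength-zero (Linked.tail l)
             (λ j< → j≮ (ℕ.<-≤-trans j< (rowLength-tail l))))

  row⇒column : ∀ {xs} → Linked _≥_ xs → ∀ i {j} →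
               j < rowLength xs i → i < columnLength xs j
  row⇒column {x ∷ xs} l zero        j<x = columnLength-pos (x ∷ xs) j<x
  row⇒column {x ∷ xs} l (suc i) {j} j<
    with i< ← row⇒column (Linked.tail l) i j< | j <? x
  ... | yes j<x = subst (suc i <_) (sym (accept xs j<x)) (s≤s i<)
  ... | no  j≮x = contradiction
    (subst (i <_) (trans (sym (reject xs j≮x)) (columnLength-zero l j≮x)) i<)
    λ ()

  column⇒row : ∀ {xs} → Linked _≥_ xs → ∀ i {j} →
               i < columnLength xs j → j < rowLength xs i
  column⇒row {x ∷ xs} l i {j} i< = helper (j <? x) i i<
    where
    helper : Dec (j < x) → ∀ i → i < columnLength (x ∷ xs) j →
             j < rowLength (x ∷ xs) i
    helper (yes j<x) zero    _  = j<x
    helper (yes j<x) (suc i) i< = column⇒row (Linked.tail l) i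
      (ℕ.s<s⁻¹ (subst (suc i <_) (accept xs j<x) i<))
    helper (no j≮x)  i       i< =
      contradiction (subst (i <_) (columnLength-zero l j≮x) i<) λ ()

  rowLength-applyUpTo : ∀ f n {j} → j < n → rowLength (applyUpTo f n) j ≡ f j
  rowLength-applyUpTo f (suc n) {zero}  _        = refl
  rowLength-applyUpTo f (suc n) {suc j} (s≤s j<) =
    rowLength-applyUpTo (f ∘ suc) n j<

  rowLength-applyUpTo-≥ : ∀ f n {j} → ¬ j < n →
                          rowLength (applyUpTo f n) j ≡ 0
  rowLength-applyUpTo-≥ f zero            _  = refl
  rowLength-applyUpTo-≥ f (suc n) {zero}  j≮ = contradiction z<s j≮
  rowLength-applyUpTo-≥ f (suc n) {suc j} j≮ =
    rowLength-applyUpTo-≥ (f ∘ suc) n (j≮ ∘ s≤s)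

  rowLength-conjugateParts : ∀ {xs} → Linked _≥_ xs → ∀ j →
    rowLength (conjugateParts xs) j ≡ columnLength xs j
  rowLength-conjugateParts {xs} l j with j <? rowLength xs 0
  ... | yes j< = rowLength-applyUpTo (columnLength xs) (rowLength xs 0) j<
  ... | no  j≮ = trans (rowLength-applyUpTo-≥ (columnLength xs) _ j≮)
                       (sym (columnLength-zero l j≮))

open ConjugateLemmas

conjugateₚ : Partition → Partition
conjugateₚ λ′ = record
  { parts      = conjugateParts (parts λ′)
  ; decreasing = Linked.applyUpTo⁺₁ _ _ (λ _ → columnLength-mono (parts λ′) _)
  ; positive   = All.applyUpTo⁺₁ _ _ (columnLength-pos (parts λ′))
  }

-- Conjugation is transposition of diagrams.
diagram-conjugate : ∀ λ′ → diagram (conjugateₚ λ′) ≐ (diagram λ′ ∘ swap)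
diagram-conjugate λ′ =
  (λ {(j , i)} i< → column⇒row (decreasing λ′) i
     (subst (i <_) (rowLength-conjugateParts (decreasing λ′) j) i<)) ,
  (λ {(j , i)} j< →
     subst (i <_) (sym (rowLength-conjugateParts (decreasing λ′) j))
       (row⇒column (decreasing λ′) i j<))

innerCorner-conjugate : ∀ λ′ c →
  InnerCorner λ′ (swap c) → InnerCorner (conjugateₚ λ′) c
innerCorner-conjugate λ′ c (c∈ , μ , μ⊆ , ⊆μ) =
  proj₂ (diagram-conjugate λ′) c∈ , conjugateₚ μ ,
  (λ d∈ → let d∈λ , d≢ = μ⊆ (proj₁ (diagram-conjugate μ) d∈) in
     proj₂ (diagram-conjugate λ′) d∈λ , d≢ ∘ cong swap) ,
  (λ (d∈ , d≢) → proj₂ (diagram-conjugate μ)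
     (⊆μ (proj₁ (diagram-conjugate λ′) d∈ , d≢ ∘ cong swap)))

------------------------------------------------------------------------
-- Overpartitions

record Overpartition : Set where
  field
    shape         : Partition
    marked        : Cell → Bool
    marked⇒corner : ∀ c → T (marked c) → InnerCorner shape c

open Overpartition public

-- The proof components of overpartitions are ignored when comparing them.
overpartitionSetoid : Setoid 0ℓ 0ℓ
overpartitionSetoid = record
  { Carrier       = Overpartition
  ; _≈_           = λ ν ρ → parts (shape ν) ≡ parts (shape ρ)
                          × (∀ c → marked ν c ≡ marked ρ c)
  ; isEquivalence = record
    { refl  = refl , λ _ → refl
    ; sym   = λ (e , m) → sym e , λ c → sym (m c)
    ; trans = λ (e , m) (f , n) → trans e f , λ c → trans (m c) (n c)
    }
  }

open Setoid overpartitionSetoid public using () renaming (_≈_ to _≈ᵒ_)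

conjugate : Overpartition → Overpartition
conjugate ν = record
  { shape         = conjugateₚ (shape ν)
  ; marked        = marked ν ∘ swap
  ; marked⇒corner = λ c m →
      innerCorner-conjugate (shape ν) c (marked⇒corner ν (swap c) m)
  }

size diag mark : Overpartition → ℕ
size ν = length (cells (shape ν))
diag ν = length (filter (λ (i , j) → i ≟ j) (cells (shape ν)))
mark ν = length (filterᵇ (marked ν) (cells (shape ν)))

SelfConjugate : Pred Overpartition 0ℓ
SelfConjugate ν = conjugate ν ≈ᵒ ν

InBox : ℕ → Pred Overpartition 0ℓ
InBox k ν = length (parts (shape ν)) ≤ k × All (_≤ k) (parts (shape ν))

SOP : ℕ → Pred Overpartition 0ℓ
SOP k ν = SelfConjugate ν × InBox k ν

-- νs lists every overpartition satisfying P exactly once, and no other.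
infix 4 _Enumerates_
record _Enumerates_ (νs : List Overpartition) (P : Pred Overpartition 0ℓ) : Set where
  open Membership overpartitionSetoid using (_∈_)
  open Unique overpartitionSetoid using (Unique)
  field
    unique : Unique νs
    member : ∀ ν → ν ∈ νs ⇔ P ν

{-# OPTIONS --safe #-}

-- A self-conjugate overpartition in the k × k box either lies in the
-- (k − 1) × (k − 1) box or has a first row of length k.  In the latter case
-- its first row and column form a hook of 2k − 1 cells around a
-- self-conjugate overpartition ν in the (k − 1) × (k − 1) box.  If the first
-- row of ν has length k − 1 the ends of the hook are not corners; otherwise
-- they may be marked together, which contributes the factor 1 − t² (or 1 + t
-- when k = 1 and the two ends coincide).  The part T_k − T_{k−1} of the
-- recurrence satisfies the same hook by hook recursion, since (k + 1)² − i²
-- exceeds k² − i² by 2k + 1.  No cancellation is needed: the two sides agree as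
-- multisets of terms.
module Submission where

open import Defs
open import Data.List.Base using (List)
open import Data.Nat.Base using (ℕ; ⌊_/2⌋) renaming (_+_ to _+ℕ_)
open import Data.Product.Base using (∃; _×_)

open import Algebra.Bundles using (module CommutativeMonoid)
import Algebra.Properties.CommutativeSemigroup as CommutativeSemigroupProperties
open import Data.Bool.Base using (Bool; true; false; T; if_then_else_; _∧_)
open import Data.Bool.Properties using (T?; T-≡; T-∧; ∧-identityʳ; ∧-zeroʳ)
open import Data.Integer.Base as ℤ using (ℤ; 0ℤ; 1ℤ; -1ℤ)
import Data.Integer.Properties as ℤ
open import Data.List.Base
  using ([]; _∷_; _++_; map; length; filter; concat; upTo; applyUpTo)
open import Data.List.Membership.Propositional using (_∈_)
open import Data.List.Membership.Propositional.Properties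
  using (∈-map⁺; ∈-map⁻; ∈-++⁺ˡ; ∈-++⁺ʳ; ∈-++⁻)
import Data.List.Membership.Setoid as SetoidMembership
import Data.List.Membership.Setoid.Properties as SetoidMembershipProperties
import Data.List.Properties as List
open import Data.List.Relation.Binary.Permutation.Propositional as ↭
  using (_↭_; ↭-refl; ↭-reflexive; ↭-trans; ↭ₛ⇒↭)
import Data.List.Relation.Binary.Permutation.Propositional.Properties as ↭
import Data.List.Relation.Binary.Permutation.Setoid as SetoidPermutation
import Data.List.Relation.Binary.Permutation.Setoid.Properties
  as SetoidPermutationProperties
open import Data.List.Relation.Unary.All as All using (All; []; _∷_)
open import Data.List.Relation.Unary.AllPairs using ([]; _∷_)
open import Data.List.Relation.Unary.Any using (here; there)
open import Data.List.Relation.Unary.Linked as Linked using (Linked; []; [-]; _∷_)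
open import Data.List.Relation.Unary.Unique.Propositional using (Unique)
import Data.List.Relation.Unary.Unique.Propositional.Properties as Unique
import Data.List.Relation.Unary.Unique.Setoid as SetoidUnique
import Data.List.Relation.Unary.Unique.Setoid.Properties as SetoidUniqueProperties
open import Data.Nat.Base as ℕ
  using (zero; suc; pred; _∸_; _≤_; _<_; _≥_; _>_; z≤n; s≤s; z<s; s<s; _≡ᵇ_)
open import Data.Nat.Properties as ℕ using (_≟_; _<?_)
open import Data.Nat.Tactic.RingSolver using (solve-∀)
open import Data.Product.Base using (_,_; proj₁; proj₂; map₂; uncurry)
open import Data.Product.Properties using (,-injectiveˡ; ,-injectiveʳ)
open import Data.Sum.Base using (inj₁; inj₂)
open import Data.Unit.Base using (tt)
open import Function.Base using (_∘_; id; const; case_of_)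
open import Function.Bundles using (Equivalence; mk⇔)
open import Level using (0ℓ)
open import Relation.Binary.Bundles using (Setoid)
open import Relation.Binary.PropositionalEquality
  using (_≡_; _≢_; _≗_; refl; sym; trans; cong; cong₂; subst; subst₂; setoid;
         module ≡-Reasoning)
open import Relation.Nullary.Decidable using (yes; no; does; dec-true; dec-false)
open import Relation.Nullary.Negation using (¬_; contradiction)
open import Relation.Unary using (Pred; Decidable)

-- Booleans, predecessors and antitone functions

T⇒≡true : ∀ {x} → T x → x ≡ true
T⇒≡true = Equivalence.to T-≡

¬T⇒≡false : ∀ {x} → ¬ T x → x ≡ false
¬T⇒≡false {false} _  = refl
¬T⇒≡false {true}  ¬t = contradiction tt ¬t

<-pred⁺ : ∀ {m n} → suc m < n → m < pred n
<-pred⁺ {n = suc n} (s<s m<n) = m<n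

<-pred⁻ : ∀ {m n} → m < pred n → suc m < n
<-pred⁻ {n = suc n} m<n = s<s m<n

antitone⇒≥ : ∀ {f : ℕ → ℕ} → (∀ a → f (suc a) ≤ f a) →
             ∀ {a b} → a ≤ b → f b ≤ f a
antitone⇒≥ {f} anti a≤b = go (ℕ.≤⇒≤′ a≤b)
  where
  go : ∀ {a b} → a ℕ.≤′ b → f b ≤ f a
  go ℕ.≤′-refl       = ℕ.≤-refl
  go (ℕ.≤′-step a≤b) = ℕ.≤-trans (anti _) (go a≤b)

-- Profiles

-- The data on which ≈ᵒ depends, with the rows padded by zeros.
record Profile : Set where
  constructor profile
  field
    rows  : ℕ → ℕ
    marks : ℕ → ℕ → Bool

open Profile

infix 4 _≈ₚ_
_≈ₚ_ : Profile → Profile → Set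
P ≈ₚ R = rows P ≗ rows R × (∀ a b → marks P a b ≡ marks R a b)

≈ₚ-sym : ∀ {P R} → P ≈ₚ R → R ≈ₚ P
≈ₚ-sym (r , m) = sym ∘ r , λ a b → sym (m a b)

≈ₚ-trans : ∀ {P R S} → P ≈ₚ R → R ≈ₚ S → P ≈ₚ S
≈ₚ-trans (r , m) (r′ , m′) = (λ a → trans (r a) (r′ a)) , λ a b → trans (m a b) (m′ a b)

-- Membership in `SOP k` expressed by inequalities between row lengths, without lists of parts or
-- the witness partition of `InnerCorner`. In `symmetric` one implication is enough, since `a` and
-- `b` may be exchanged.
record Valid (k : ℕ) (P : Profile) : Set where
  field
    antitone  : ∀ a → rows P (suc a) ≤ rows P a
    bounded   : rows P 0 ≤ k
    symmetric : ∀ a b → b < rows P a → a < rows P b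
    marks-sym : ∀ a b → marks P a b ≡ marks P b a
    corner    : ∀ a b → T (marks P a b) → rows P a ≡ suc b × rows P (suc a) ≤ b

  -- A cell in row `a` gives by symmetry the cell `(0 , a)`, so the bound on the first row also
  -- bounds the number of rows.
  support : ∀ a → 0 < rows P a → a < k
  support a 0<r = ℕ.<-≤-trans (symmetric a 0 0<r) bounded

  vanishing : ∀ a → ¬ a < k → rows P a ≡ 0
  vanishing a a≮k = ℕ.n≤0⇒n≡0 (ℕ.≮⇒≥ (a≮k ∘ support a))

open Valid

Valid-resp-≈ₚ : ∀ {k P R} → P ≈ₚ R → Valid k P → Valid k R
Valid-resp-≈ₚ (r , m) v = record
  { antitone  = λ a → subst₂ _≤_ (r (suc a)) (r a) (antitone v a)
  ; bounded   = subst (_≤ _) (r 0) (bounded v)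
  ; symmetric = λ a b b< →
      subst (a <_) (r b) (symmetric v a b (subst (b <_) (sym (r a)) b<))
  ; marks-sym = λ a b → trans (sym (m a b)) (trans (marks-sym v a b) (m b a))
  ; corner    = λ a b c → let e , l = corner v a b (subst T (sym (m a b)) c) in
      trans (sym (r a)) e , subst (_≤ b) (r (suc a)) l
  }

Valid-weaken : ∀ {k l P} → k ≤ l → Valid k P → Valid l P
Valid-weaken k≤l v = record
  { antitone  = antitone v
  ; bounded   = ℕ.≤-trans (bounded v) k≤l
  ; symmetric = symmetric v
  ; marks-sym = marks-sym v
  ; corner    = corner v
  }

Valid-restrict : ∀ {k P} → rows P 0 ≢ suc k → Valid (suc k) P → Valid k P
Valid-restrict r≢ v = record
  { antitone  = antitone v
  ; bounded   = ℕ.m<1+n⇒m≤n (ℕ.≤∧≢⇒< (bounded v) r≢)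
  ; symmetric = symmetric v
  ; marks-sym = marks-sym v
  ; corner    = corner v
  }

-- The empty profile and the hook construction

∅ : Profile
∅ = profile (const 0) (λ _ _ → false)

∅-valid : Valid 0 ∅
∅-valid = record
  { antitone  = λ _ → z≤n
  ; bounded   = z≤n
  ; symmetric = λ _ _ ()
  ; marks-sym = λ _ _ → refl
  ; corner    = λ _ _ ()
  }

Valid-0⇒∅ : ∀ {P} → Valid 0 P → ∅ ≈ₚ P
Valid-0⇒∅ v = (λ a → sym (vanishing v a λ ())) , λ a b →
  sym (¬T⇒≡false λ m → case trans (sym (proj₁ (corner v a b m))) (vanishing v a λ ()) of λ ())

-- The cut-off at n discards rows of f that would not fit inside the hook.
hookRows : ℕ → (ℕ → ℕ) → ℕ → ℕ
hookRows n f zero    = suc n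
hookRows n f (suc a) = if does (a <? n) then suc (f a) else 0

-- One Boolean marks both ends `(0 , n)` and `(n , 0)`, as self-conjugacy forces. For `n = 0` they
-- are the same cell, which only the first clause can mark.
hookMarks : Bool → ℕ → (ℕ → ℕ → Bool) → ℕ → ℕ → Bool
hookMarks x n m zero    b       = x ∧ (b ≡ᵇ n)
hookMarks x n m (suc a) zero    = x ∧ (suc a ≡ᵇ n)
hookMarks x n m (suc a) (suc b) = m a b

hook : Bool → ℕ → Profile → Profile
hook x n P = profile (hookRows n (rows P)) (hookMarks x n (marks P))

hookRows-< : ∀ {n} f {a} → a < n → hookRows n f (suc a) ≡ suc (f a)
hookRows-< {n} f {a} a<n =
  cong (if_then suc (f a) else 0) (dec-true (a <? n) a<n)

hookRows-≮ : ∀ {n} f {a} → ¬ a < n → hookRows n f (suc a) ≡ 0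
hookRows-≮ {n} f {a} a≮n =
  cong (if_then suc (f a) else 0) (dec-false (a <? n) a≮n)

hookRows-≤ : ∀ n f {a b} → f a ≤ b → hookRows n f (suc a) ≤ suc b
hookRows-≤ n f {a} {b} fa≤b with a <? n
... | yes a<n = subst (_≤ suc b) (sym (hookRows-< f a<n)) (s≤s fa≤b)
... | no  a≮n = subst (_≤ suc b) (sym (hookRows-≮ f a≮n)) z≤n

hookRows-∈ : ∀ n f {a b} → b < hookRows n f (suc a) → a < n × b ≤ f a
hookRows-∈ n f {a} {b} b< with a <? n
... | yes a<n = a<n , ℕ.m<1+n⇒m≤n (subst (b <_) (hookRows-< f a<n) b<)
... | no  a≮n = contradiction (subst (b <_) (hookRows-≮ f a≮n) b<) λ ()

-- The first hypothesis keeps row 1 out of column `n` when the ends are marked, so that `(0 , n)`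
-- has no cell below it; symmetry then settles the other end.
hook-valid : ∀ {x n P} → (T x → hookRows n (rows P) 1 ≤ n) →
             Valid n P → Valid (suc n) (hook x n P)
hook-valid {x} {n} {P} free v = record
  { antitone  = anti
  ; bounded   = ℕ.≤-refl
  ; symmetric = symm
  ; marks-sym = msym
  ; corner    = corn
  }
  where
  f = rows P
  r = hookRows n f

  anti : ∀ a → r (suc a) ≤ r a
  anti zero    = hookRows-≤ n f (bounded v)
  anti (suc a) with a <? n
  ... | yes a<n = subst (r (2 ℕ.+ a) ≤_) (sym (hookRows-< f a<n)) (hookRows-≤ n f (antitone v a))
  ... | no  a≮n = subst (_≤ r (suc a)) (sym (hookRows-≮ f (a≮n ∘ ℕ.<-trans (ℕ.n<1+n a)))) z≤n

  symm : ∀ a b → b < r a → a < r b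
  symm zero    zero    _         = z<s
  symm zero    (suc b) (s<s b<n) = subst (0 <_) (sym (hookRows-< f b<n)) z<s
  symm (suc a) zero    0<        = s<s (proj₁ (hookRows-∈ n f 0<))
  symm (suc a) (suc b) b<        =
    let a<fb = symmetric v a b (proj₂ (hookRows-∈ n f b<))
        b<n  = support v b (ℕ.≤-<-trans z≤n a<fb)
    in subst (suc a <_) (sym (hookRows-< f b<n)) (s<s a<fb)

  msym : ∀ a b → hookMarks x n (marks P) a b ≡ hookMarks x n (marks P) b a
  msym zero    zero    = refl
  msym zero    (suc b) = refl
  msym (suc a) zero    = refl
  msym (suc a) (suc b) = marks-sym v a b

  end : ∀ {c} → T (x ∧ (c ≡ᵇ n)) → T x × c ≡ n
  end {c} e = map₂ (ℕ.≡ᵇ⇒≡ c n) (Equivalence.to T-∧ e)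

  corn : ∀ a b → T (hookMarks x n (marks P) a b) → r a ≡ suc b × r (suc a) ≤ b
  corn zero b m with Tx , refl ← end {b} m = refl , free Tx
  -- Here `n` is `suc a`. The first row of `P` has length at most `a`, so by symmetry row `a` of `P`
  -- is empty and the last row of the hook is a single cell.
  corn (suc a) zero m with Tx , refl ← end {suc a} m =
    trans (hookRows-< f a<n) (cong suc fa≡0) ,
    ℕ.≤-reflexive (hookRows-≮ f (ℕ.<-irrefl refl))
    where
    a<n = ℕ.n<1+n a
    f0≤a = ℕ.s≤s⁻¹ (subst (_≤ suc a) (hookRows-< {suc a} f z<s) (free Tx))
    fa≡0 : f a ≡ 0
    fa≡0 = ℕ.n≤0⇒n≡0 (ℕ.≮⇒≥ λ 0<fa → ℕ.<⇒≱ (symmetric v a 0 0<fa) f0≤a)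
  corn (suc a) (suc b) m =
    let fa≡ , fsa≤ = corner v a b m
        a<n = support v a (subst (0 <_) (sym fa≡) z<s)
    in trans (hookRows-< f a<n) (cong suc fa≡) , hookRows-≤ n f fsa≤

hook-cong : ∀ x n {P R} → P ≈ₚ R → hook x n P ≈ₚ hook x n R
hook-cong x n {P} {R} (r , m) = r′ , m′
  where
  r′ : rows (hook x n P) ≗ rows (hook x n R)
  r′ zero    = refl
  r′ (suc a) = cong (λ z → if does (a <? n) then suc z else 0) (r a)
  m′ : ∀ a b → marks (hook x n P) a b ≡ marks (hook x n R) a b
  m′ zero    b       = refl
  m′ (suc a) zero    = refl
  m′ (suc a) (suc b) = m a b

-- The mark at `(0 , n)` recovers the Boolean. The cut-off hides the rows from index `n` on, but
-- validity makes them zero in both profiles.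
hook-injective : ∀ {x y n P R} → Valid n P → Valid n R →
                 hook x n P ≈ₚ hook y n R → x ≡ y × P ≈ₚ R
hook-injective {x} {y} {n} {P} {R} v w (r , m) =
  subst (λ e → x ∧ e ≡ y ∧ e → x ≡ y) (sym (T⇒≡true (ℕ.≡⇒≡ᵇ n n refl)))
    (λ e → trans (sym (∧-identityʳ x)) (trans e (∧-identityʳ y))) (m 0 n) ,
  r′ , λ a b → m (suc a) (suc b)
  where
  r′ : rows P ≗ rows R
  r′ a with a <? n
  ... | yes a<n = ℕ.suc-injective
    (trans (sym (hookRows-< (rows P) a<n)) (trans (r (suc a)) (hookRows-< (rows R) a<n)))
  ... | no  a≮n = trans (vanishing v a a≮n) (sym (vanishing w a a≮n))

-- Removal of the outer hook

peel : Profile → Profile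
peel P = profile (pred ∘ rows P ∘ suc) (λ a b → marks P (suc a) (suc b))

peel-valid : ∀ {n P} → Valid (suc n) P → Valid n (peel P)
peel-valid v = record
  { antitone  = λ a → ℕ.pred-mono-≤ (antitone v (suc a))
  ; bounded   = ℕ.pred-mono-≤ (ℕ.≤-trans (antitone v 0) (bounded v))
  ; symmetric = λ a b → <-pred⁺ ∘ symmetric v (suc a) (suc b) ∘ <-pred⁻
  ; marks-sym = λ a b → marks-sym v (suc a) (suc b)
  ; corner    = λ a b m → let e , l = corner v (suc a) (suc b) m in
      cong pred e , ℕ.pred-mono-≤ l
  }

hook-peel : ∀ {n P} → Valid (suc n) P → rows P 0 ≡ suc n →
            hook (marks P 0 n) n (peel P) ≈ₚ P
hook-peel {n} {P} v r0 = r , m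
  where
  r : rows (hook (marks P 0 n) n (peel P)) ≗ rows P
  r zero    = sym r0
  r (suc a) with a <? n
  -- The first row is full, so by symmetry row `suc a` is nonempty and `pred` loses nothing.
  ... | yes a<n = trans (hookRows-< (rows (peel P)) a<n)
    (ℕ.suc-pred (rows P (suc a)) {{ℕ.>-nonZero (symmetric v 0 (suc a)
      (subst (suc a <_) (sym r0) (s<s a<n)))}})
  ... | no  a≮n = trans (hookRows-≮ (rows (peel P)) a≮n)
    (sym (vanishing v (suc a) (a≮n ∘ ℕ.s<s⁻¹)))

  edge : ∀ b → marks P 0 n ∧ (b ≡ᵇ n) ≡ marks P 0 b
  edge b with b ≟ n
  ... | yes refl = trans (cong (marks P 0 b ∧_) (T⇒≡true (ℕ.≡⇒≡ᵇ b b refl))) (∧-identityʳ _)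
  -- A marked cell of the first row must end that row, which puts it in column `n`.
  ... | no  b≢n  = trans
    (trans (cong (marks P 0 n ∧_) (¬T⇒≡false (b≢n ∘ ℕ.≡ᵇ⇒≡ b n))) (∧-zeroʳ _))
    (sym (¬T⇒≡false λ c →
      b≢n (ℕ.suc-injective (trans (sym (proj₁ (corner v 0 b c))) r0))))

  m : ∀ a b → marks (hook (marks P 0 n) n (peel P)) a b ≡ marks P a b
  m zero    b       = edge b
  m (suc a) zero    = trans (edge (suc a)) (marks-sym v 0 (suc a))
  m (suc a) (suc b) = refl

-- Elements of SOP k, and those among them whose first row has length k.  The
-- ends of an outer hook carry no marks because they are not corners.
mutual
  data Code : ℕ → Set where
    empty : Code 0
    widen : ∀ {n} → Code n → Code (suc n)
    full  : ∀ {n} → Full (suc n) → Code (suc n)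

  data Full : ℕ → Set where
    single : Bool → Full 1
    inner  : ∀ {n} → Bool → Code n → Full (2 ℕ.+ n)
    outer  : ∀ {n} → Full n → Full (suc n)

mutual
  ⟦_⟧ : ∀ {k} → Code k → Profile
  ⟦ empty ⟧   = ∅
  ⟦ widen c ⟧ = ⟦ c ⟧
  ⟦ full c ⟧  = ⟦ c ⟧ᶠ

  ⟦_⟧ᶠ : ∀ {k} → Full k → Profile
  ⟦ single x ⟧ᶠ        = hook x 0 ∅
  ⟦ inner {n} x c ⟧ᶠ   = hook x (suc n) ⟦ c ⟧
  ⟦ outer {n} c ⟧ᶠ     = hook false n ⟦ c ⟧ᶠ

rows-full : ∀ {k} (c : Full k) → rows ⟦ c ⟧ᶠ 0 ≡ k
rows-full (single x)  = refl
rows-full (inner x c) = refl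
rows-full (outer c)   = refl

mutual
  ⟦⟧-valid : ∀ {k} (c : Code k) → Valid k ⟦ c ⟧
  ⟦⟧-valid empty     = ∅-valid
  ⟦⟧-valid (widen c) = Valid-weaken (ℕ.n≤1+n _) (⟦⟧-valid c)
  ⟦⟧-valid (full c)  = ⟦⟧ᶠ-valid c

  ⟦⟧ᶠ-valid : ∀ {k} (c : Full k) → Valid k ⟦ c ⟧ᶠ
  ⟦⟧ᶠ-valid (single x)  = hook-valid (λ _ → z≤n) ∅-valid
  ⟦⟧ᶠ-valid (inner x c) = hook-valid (λ _ → s≤s (bounded (⟦⟧-valid c)))
                                     (Valid-weaken (ℕ.n≤1+n _) (⟦⟧-valid c))
  ⟦⟧ᶠ-valid (outer c)   = hook-valid (λ ()) (⟦⟧ᶠ-valid c)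

mutual
  encode : ∀ k {P} → Valid k P → ∃ λ (c : Code k) → ⟦ c ⟧ ≈ₚ P
  encode zero    v = empty , Valid-0⇒∅ v
  encode (suc n) {P} v with rows P 0 ≟ suc n
  ... | yes r0 = let c , e = encodeFull n v r0 in full c , e
  ... | no  r0 = let c , e = encode n (Valid-restrict r0 v) in widen c , e

  encodeFull : ∀ n {P} → Valid (suc n) P → rows P 0 ≡ suc n →
               ∃ λ (c : Full (suc n)) → ⟦ c ⟧ᶠ ≈ₚ P
  encodeFull zero    {P} v r0 = single (marks P 0 0) ,
    ≈ₚ-trans (hook-cong (marks P 0 0) 0 (Valid-0⇒∅ (peel-valid v))) (hook-peel v r0)
  encodeFull (suc n) {P} v r0 with rows (peel P) 0 ≟ suc n
  ... | yes r1 =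
    let c , e = encodeFull n (peel-valid v) r1
        -- Row 1 of `P` reaches column `suc n`, so the end `(0 , suc n)` has a cell below it and is
        -- not a corner.
        unmarked = ¬T⇒≡false λ m → ℕ.<⇒≱ (<-pred⁻ (ℕ.≤-reflexive (sym r1)))
                                         (proj₂ (corner v 0 (suc n) m))
    in outer c , ≈ₚ-trans (hook-cong false (suc n) e)
         (subst (λ x → hook x (suc n) (peel P) ≈ₚ P) unmarked (hook-peel v r0))
  ... | no  r1 =
    let c , e = encode n (Valid-restrict r1 (peel-valid v))
    in inner (marks P 0 (suc n)) c ,
       ≈ₚ-trans (hook-cong (marks P 0 (suc n)) (suc n) e) (hook-peel v r0)

-- The first rows differ: at most `n` against exactly `suc n`. This separates `widen` from `full`
-- and `inner` from `outer`.
Code≉Full : ∀ {n} (c : Code n) (d : Full (suc n)) → ¬ ⟦ c ⟧ ≈ₚ ⟦ d ⟧ᶠ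
Code≉Full c d (r , _) =
  ℕ.<⇒≱ (ℕ.≤-reflexive (sym (trans (r 0) (rows-full d)))) (bounded (⟦⟧-valid c))

mutual
  ⟦⟧-injective : ∀ {k} (c d : Code k) → ⟦ c ⟧ ≈ₚ ⟦ d ⟧ → c ≡ d
  ⟦⟧-injective empty     empty     e = refl
  ⟦⟧-injective (widen c) (widen d) e = cong widen (⟦⟧-injective c d e)
  ⟦⟧-injective (widen c) (full d)  e = contradiction e (Code≉Full c d)
  ⟦⟧-injective (full c)  (widen d) e = contradiction (≈ₚ-sym e) (Code≉Full d c)
  ⟦⟧-injective (full c)  (full d)  e = cong full (⟦⟧ᶠ-injective c d e)

  ⟦⟧ᶠ-injective : ∀ {k} (c d : Full k) → ⟦ c ⟧ᶠ ≈ₚ ⟦ d ⟧ᶠ → c ≡ d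
  ⟦⟧ᶠ-injective (single x)  (single y)  e =
    cong single (proj₁ (hook-injective ∅-valid ∅-valid e))
  ⟦⟧ᶠ-injective (inner x c) (inner y d) e =
    let x≡y , e′ = hook-injective (⟦⟧-valid (widen c)) (⟦⟧-valid (widen d)) e
    in cong₂ inner x≡y (⟦⟧-injective c d e′)
  ⟦⟧ᶠ-injective (inner x c) (outer d)   e =
    contradiction (proj₂ (hook-injective (⟦⟧-valid (widen c)) (⟦⟧ᶠ-valid d) e)) (Code≉Full c d)
  ⟦⟧ᶠ-injective (outer c)   (inner y d) e =
    contradiction (proj₂ (hook-injective (⟦⟧-valid (widen d)) (⟦⟧ᶠ-valid c) (≈ₚ-sym e))) (Code≉Full d c)
  ⟦⟧ᶠ-injective (outer c)   (outer d)   e =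
    cong outer (⟦⟧ᶠ-injective c d (proj₂ (hook-injective (⟦⟧ᶠ-valid c) (⟦⟧ᶠ-valid d) e)))
  ⟦⟧ᶠ-injective (single _)  (outer ())
  ⟦⟧ᶠ-injective (outer ())  (single _)

-- Enumeration of the codes

mutual
  codes : ∀ k → List (Code k)
  codes zero    = empty ∷ []
  codes (suc n) = map widen (codes n) ++ map full (fulls (suc n))

  -- The order of the three blocks is that of the summands in `gain-suc`.
  fulls : ∀ k → List (Full k)
  fulls zero          = []
  fulls (suc zero)    = single false ∷ single true ∷ []
  fulls (suc (suc n)) =
    map outer (fulls (suc n)) ++ map (inner false) (codes n) ++ map (inner true) (codes n)

mutual
  ∈-codes : ∀ {k} (c : Code k) → c ∈ codes k
  ∈-codes empty           = here refl
  ∈-codes (widen c)       = ∈-++⁺ˡ (∈-map⁺ widen (∈-codes c))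
  ∈-codes (full {n} c)    = ∈-++⁺ʳ (map widen (codes n)) (∈-map⁺ full (∈-fulls c))

  ∈-fulls : ∀ {k} (c : Full k) → c ∈ fulls k
  ∈-fulls (single false)      = here refl
  ∈-fulls (single true)       = there (here refl)
  ∈-fulls (inner {n} false c) =
    ∈-++⁺ʳ (map outer (fulls (suc n))) (∈-++⁺ˡ (∈-map⁺ (inner false) (∈-codes c)))
  ∈-fulls (inner {n} true c)  =
    ∈-++⁺ʳ (map outer (fulls (suc n)))
      (∈-++⁺ʳ (map (inner false) (codes n)) (∈-map⁺ (inner true) (∈-codes c)))
  ∈-fulls (outer {suc n} c)   = ∈-++⁺ˡ (∈-map⁺ outer (∈-fulls c))

mutual
  codes-unique : ∀ k → Unique (codes k)
  codes-unique zero    = [] ∷ []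
  codes-unique (suc n) = Unique.++⁺
    (Unique.map⁺ (λ { refl → refl }) (codes-unique n))
    (Unique.map⁺ (λ { refl → refl }) (fulls-unique (suc n)))
    λ (p , r) → case ∈-map⁻ widen p , ∈-map⁻ full r of λ
      { ((_ , _ , refl) , (_ , _ , ())) }

  fulls-unique : ∀ k → Unique (fulls k)
  fulls-unique zero          = []
  fulls-unique (suc zero)    = ((λ ()) ∷ []) ∷ [] ∷ []
  fulls-unique (suc (suc n)) = Unique.++⁺
    (Unique.map⁺ (λ { refl → refl }) (fulls-unique (suc n)))
    (Unique.++⁺
      (Unique.map⁺ (λ { refl → refl }) (codes-unique n))
      (Unique.map⁺ (λ { refl → refl }) (codes-unique n))
      λ (p , r) → case ∈-map⁻ (inner false) p , ∈-map⁻ (inner true) r of λ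
        { ((_ , _ , refl) , (_ , _ , ())) })
    λ (p , r) → case ∈-map⁻ outer p , ∈-++⁻ (map (inner false) (codes n)) r of λ
      { ((_ , _ , refl) , inj₁ r) → case ∈-map⁻ (inner false) r of λ { (_ , _ , ()) }
      ; ((_ , _ , refl) , inj₂ r) → case ∈-map⁻ (inner true) r of λ { (_ , _ , ()) } }

-- Row lengths of partitions

rowLength-antitone : ∀ {xs} → Linked _≥_ xs → ∀ a → rowLength xs (suc a) ≤ rowLength xs a
rowLength-antitone {[]}     _ _       = z≤n
rowLength-antitone {x ∷ xs} l zero    = ConjugateLemmas.rowLength-tail l
rowLength-antitone {x ∷ xs} l (suc a) = rowLength-antitone (Linked.tail l) a

rowLength-antitone⁻ : ∀ {xs} → (∀ a → rowLength xs (suc a) ≤ rowLength xs a) → Linked _≥_ xs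
rowLength-antitone⁻ {[]}         _    = []
rowLength-antitone⁻ {x ∷ []}     _    = [-]
rowLength-antitone⁻ {x ∷ y ∷ xs} anti = anti 0 ∷ rowLength-antitone⁻ (anti ∘ suc)

-- Positive parts cannot be confused with the zeros of the padding.
rowLength-injective : ∀ {xs ys} → All (_> 0) xs → All (_> 0) ys →
                      rowLength xs ≗ rowLength ys → xs ≡ ys
rowLength-injective []       []       e = refl
rowLength-injective []       (y ∷ ys) e = contradiction (subst (_> 0) (sym (e 0)) y) λ ()
rowLength-injective (x ∷ xs) []       e = contradiction (subst (_> 0) (e 0) x) λ ()
rowLength-injective (x ∷ xs) (y ∷ ys) e = cong₂ _∷_ (e 0) (rowLength-injective xs ys (e ∘ suc))

rowLength-length : ∀ xs {a} → length xs ≤ a → rowLength xs a ≡ 0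
rowLength-length []               _       = refl
rowLength-length (x ∷ xs) {suc a} (s≤s l) = rowLength-length xs l

rowLength-zero⇒length : ∀ {xs} → All (_> 0) xs → ∀ {a} → rowLength xs a ≡ 0 → length xs ≤ a
rowLength-zero⇒length []        _           = z≤n
rowLength-zero⇒length (x ∷ xs) {zero}  e = contradiction (subst (_> 0) e x) λ ()
rowLength-zero⇒length (x ∷ xs) {suc a} e = s≤s (rowLength-zero⇒length xs e)

All-≤⇒rowLength : ∀ {k xs} → All (_≤ k) xs → ∀ a → rowLength xs a ≤ k
All-≤⇒rowLength []       _       = z≤n
All-≤⇒rowLength (x ∷ xs) zero    = x
All-≤⇒rowLength (x ∷ xs) (suc a) = All-≤⇒rowLength xs a

rowLength⇒All-≤ : ∀ {k xs} → (∀ a → rowLength xs a ≤ k) → All (_≤ k) xs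
rowLength⇒All-≤ {xs = []}     _ = []
rowLength⇒All-≤ {xs = x ∷ xs} h = h 0 ∷ rowLength⇒All-≤ (h ∘ suc)

-- Stopping at the first zero makes all parts positive for every `f`; `k` only bounds the search.
trim : ℕ → (ℕ → ℕ) → List ℕ
trim zero    f = []
trim (suc k) f with f 0
... | zero  = []
... | suc r = suc r ∷ trim k (f ∘ suc)

trim-positive : ∀ k f → All (_> 0) (trim k f)
trim-positive zero    f = []
trim-positive (suc k) f with f 0
... | zero  = []
... | suc r = z<s ∷ trim-positive k (f ∘ suc)

rowLength-trim : ∀ k {f} → (∀ a → f (suc a) ≤ f a) → f k ≡ 0 → rowLength (trim k f) ≗ f
rowLength-trim zero    {f} anti fk a = sym (ℕ.n≤0⇒n≡0 (subst (f a ≤_) fk (antitone⇒≥ anti {0} {a} z≤n)))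
rowLength-trim (suc k) {f} anti fk a with f 0 in eq
... | zero  = sym (ℕ.n≤0⇒n≡0 (subst (f a ≤_) eq (antitone⇒≥ anti {0} {a} z≤n)))
rowLength-trim (suc k) {f} anti fk zero    | suc r = sym eq
rowLength-trim (suc k) {f} anti fk (suc a) | suc r = rowLength-trim k (anti ∘ suc) fk a

fromRows : ∀ k {f} → (∀ a → f (suc a) ≤ f a) → f k ≡ 0 →
           ∃ λ λ′ → rowLength (parts λ′) ≗ f
fromRows k {f} anti fk = record
  { parts      = trim k f
  ; decreasing = rowLength-antitone⁻ λ a → subst₂ _≤_ (sym (r (suc a))) (sym (r a)) (anti a)
  ; positive   = trim-positive k f
  } , r
  where r = rowLength-trim k anti fk

-- Inner corners in terms of row lengths

module _ (λ′ : Partition) where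

  private f = rowLength (parts λ′)

  corner⇒innerCorner : ∀ {a b} → f a ≡ suc b → f (suc a) ≤ b → InnerCorner λ′ (a , b)
  corner⇒innerCorner {a} {b} fa fsa = ℕ.≤-reflexive (sym fa) , μ , to , from
    where
    -- Row `a` loses its last cell. The result is still antitone because row `suc a` has length at
    -- most `b`.
    g : ℕ → ℕ
    g x = if does (x ≟ a) then b else f x

    g-≡ : g a ≡ b
    g-≡ = cong (if_then b else f a) (dec-true (a ≟ a) refl)

    g-≢ : ∀ {x} → x ≢ a → g x ≡ f x
    g-≢ {x} x≢a = cong (if_then b else f x) (dec-false (x ≟ a) x≢a)

    g≤f : ∀ x → g x ≤ f x
    g≤f x with x ≟ a
    ... | yes refl = subst₂ _≤_ (sym g-≡) (sym fa) (ℕ.n≤1+n b)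
    ... | no  x≢a  = ℕ.≤-reflexive (g-≢ x≢a)

    anti : ∀ x → g (suc x) ≤ g x
    anti x with x ≟ a
    ... | yes refl = subst₂ _≤_ (sym (g-≢ ℕ.1+n≢n)) (sym g-≡) fsa
    ... | no  x≢a  = subst (g (suc x) ≤_) (sym (g-≢ x≢a))
                       (ℕ.≤-trans (g≤f (suc x)) (rowLength-antitone (decreasing λ′) x))

    n = length (parts λ′)

    rows-μ = fromRows n anti (ℕ.n≤0⇒n≡0 (subst (g n ≤_) (rowLength-length (parts λ′) ℕ.≤-refl) (g≤f n)))
    μ = proj₁ rows-μ
    r = proj₂ rows-μ

    to : ∀ {c} → diagram μ c → diagram λ′ c × (a , b) ≢ c
    to {x , y} y< = ℕ.<-≤-trans y<g (g≤f x) , λ { refl → ℕ.<-irrefl (sym g-≡) y<g }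
      where y<g = subst (y <_) (r x) y<

    from : ∀ {c} → diagram λ′ c × (a , b) ≢ c → diagram μ c
    from {x , y} (y<f , c≢) with x ≟ a
    ... | yes refl = subst (y <_) (sym (trans (r x) g-≡))
      (ℕ.≤∧≢⇒< (ℕ.m<1+n⇒m≤n (subst (y <_) fa y<f)) (c≢ ∘ cong (x ,_) ∘ sym))
    ... | no  x≢a  = subst (y <_) (sym (trans (r x) (g-≢ x≢a))) y<f

  -- A cell directly to the right of `(a , b)` or directly below it would belong to `μ`, and then so
  -- would `(a , b)`, because `μ` is a partition.
  innerCorner⇒corner : ∀ {a b} → InnerCorner λ′ (a , b) → f a ≡ suc b × f (suc a) ≤ b
  innerCorner⇒corner {a} {b} (b<fa , μ , to , from) =
    ℕ.≤-antisym (ℕ.≮⇒≥ λ sb<fa → notin (ℕ.<-trans (ℕ.n<1+n b)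
                   (from {a , suc b} (sb<fa , λ e → ℕ.1+n≢n (sym (,-injectiveʳ e)))))) b<fa ,
    ℕ.≮⇒≥ λ b<fsa → notin (ℕ.<-≤-trans
                   (from {suc a , b} (b<fsa , λ e → ℕ.1+n≢n (sym (,-injectiveˡ e))))
                   (rowLength-antitone (decreasing μ) a))
    where
    notin : ¬ diagram μ (a , b)
    notin c∈μ = proj₂ (to c∈μ) refl

-- Overpartitions and valid profiles

profileOf : Overpartition → Profile
profileOf ν = profile (rowLength (parts (shape ν))) (λ a b → marked ν (a , b))

profileOf-cong : ∀ ν ρ → ν ≈ᵒ ρ → profileOf ν ≈ₚ profileOf ρ
profileOf-cong ν ρ (e , m) = (λ a → cong (λ xs → rowLength xs a) e) , λ a b → m (a , b)

profileOf-injective : ∀ ν ρ → profileOf ν ≈ₚ profileOf ρ → ν ≈ᵒ ρ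
profileOf-injective ν ρ (r , m) =
  rowLength-injective (positive (shape ν)) (positive (shape ρ)) r , uncurry m

SOP⇒Valid : ∀ {k} ν → SOP k ν → Valid k (profileOf ν)
SOP⇒Valid {k} ν ((conj , msym) , _ , cols≤k) = record
  { antitone  = rowLength-antitone l
  ; bounded   = All-≤⇒rowLength cols≤k 0
  ; symmetric = λ a b b< → subst (a <_)
      (trans (sym (ConjugateLemmas.rowLength-conjugateParts l b)) (cong (λ xs → rowLength xs b) conj))
      (ConjugateLemmas.row⇒column l a b<)
  ; marks-sym = λ a b → sym (msym (a , b))
  ; corner    = λ a b m → innerCorner⇒corner (shape ν) (marked⇒corner ν (a , b) m)
  }
  where l = decreasing (shape ν)

Valid⇒SOP : ∀ {k} ν → Valid k (profileOf ν) → SOP k ν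
Valid⇒SOP {k} ν v =
  (rowLength-injective (positive (conjugateₚ (shape ν))) (positive (shape ν)) conj ,
   λ (a , b) → marks-sym v b a) ,
  rowLength-zero⇒length (positive (shape ν)) (vanishing v k (ℕ.<-irrefl refl)) ,
  rowLength⇒All-≤ (λ a → ℕ.≤-trans (antitone⇒≥ (antitone v) {0} {a} z≤n) (bounded v))
  where
  xs = parts (shape ν)
  l  = decreasing (shape ν)
  conj : rowLength (conjugateParts xs) ≗ rowLength xs
  -- If row `b`, of length `i`, were shorter than column `b`, then `(i , b)` would be a cell and by
  -- symmetry so would `(b , i)`, beyond the end of row `b`. The other case is the transposed
  -- argument.
  conj b = trans (ConjugateLemmas.rowLength-conjugateParts l b) (ℕ.≤-antisym
    (ℕ.≮⇒≥ λ r<c → ℕ.<-irrefl refl (symmetric v _ b (ConjugateLemmas.column⇒row l _ r<c)))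
    (ℕ.≮⇒≥ λ c<r → ℕ.<-irrefl refl (ConjugateLemmas.row⇒column l _ (symmetric v b _ c<r))))

realize : ∀ {k P} → Valid k P → ∃ λ ν → profileOf ν ≈ₚ P
realize {k} {P} v = record
  { shape         = λ′
  ; marked        = uncurry (marks P)
  ; marked⇒corner = λ (a , b) m → let e , s = corner v a b m in
      corner⇒innerCorner λ′ (trans (r a) e) (subst (_≤ b) (sym (r (suc a))) s)
  } , r , λ _ _ → refl
  where
  rows-λ = fromRows k (antitone v) (vanishing v k (ℕ.<-irrefl refl))
  λ′ = proj₁ rows-λ
  r  = proj₂ rows-λ

-- The enumeration of `SOP k` by codes

overpartition : ∀ {k} → Code k → Overpartition
overpartition c = proj₁ (realize (⟦⟧-valid c))

profile-overpartition : ∀ {k} (c : Code k) → profileOf (overpartition c) ≈ₚ ⟦ c ⟧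
profile-overpartition c = proj₂ (realize (⟦⟧-valid c))

overpartition-SOP : ∀ {k} (c : Code k) → SOP k (overpartition c)
overpartition-SOP c =
  Valid⇒SOP (overpartition c) (Valid-resp-≈ₚ (≈ₚ-sym (profile-overpartition c)) (⟦⟧-valid c))

SOP-resp-≈ᵒ : ∀ {k} ν ρ → ν ≈ᵒ ρ → SOP k ν → SOP k ρ
SOP-resp-≈ᵒ ν ρ e s = Valid⇒SOP ρ (Valid-resp-≈ₚ (profileOf-cong ν ρ e) (SOP⇒Valid ν s))

sops : ℕ → List Overpartition
sops k = map overpartition (codes k)

-- Distinct codes have distinct profiles, and `encode` finds a code for every valid profile.
sops-enumerates : ∀ k → sops k Enumerates SOP k
sops-enumerates k = record
  { unique = SetoidUniqueProperties.map⁺ (setoid _) overpartitionSetoid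
      (λ {c} {d} e → ⟦⟧-injective c d (≈ₚ-trans (≈ₚ-sym (profile-overpartition c))
         (≈ₚ-trans (profileOf-cong (overpartition c) (overpartition d) e) (profile-overpartition d))))
      (codes-unique k)
  ; member = λ ν → mk⇔
      (λ ν∈ → let c , _ , e = SetoidMembershipProperties.∈-map⁻ (setoid _) overpartitionSetoid {v = ν} {f = overpartition} ν∈
              in SOP-resp-≈ᵒ (overpartition c) ν (≈ᵒ-sym {ν} {overpartition c} e) (overpartition-SOP c))
      (λ s → let c , e = encode k (SOP⇒Valid ν s)
             in SetoidMembershipProperties.∈-resp-≈ overpartitionSetoid {x = overpartition c} {y = ν}
                  (profileOf-injective (overpartition c) ν (≈ₚ-trans (profile-overpartition c) e))
                  (SetoidMembershipProperties.∈-map⁺ (setoid _) overpartitionSetoid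
                    {f = overpartition} (λ {c} → λ { refl → ≈ᵒ-refl {overpartition c} }) {v = c} (∈-codes c)))
  }
  where open Setoid overpartitionSetoid using () renaming (sym to ≈ᵒ-sym; refl to ≈ᵒ-refl)

-- Cell counts

sumBelow : ℕ → (ℕ → ℕ) → ℕ
sumBelow zero    g = 0
sumBelow (suc n) g = g 0 +ℕ sumBelow n (g ∘ suc)

sumBelow-cong : ∀ n {g h} → (∀ a → a < n → g a ≡ h a) → sumBelow n g ≡ sumBelow n h
sumBelow-cong zero    e = refl
sumBelow-cong (suc n) e = cong₂ _+ℕ_ (e 0 z<s) (sumBelow-cong n λ a a<n → e (suc a) (s<s a<n))

sumBelow-+ : ∀ n g h → sumBelow n (λ a → g a +ℕ h a) ≡ sumBelow n g +ℕ sumBelow n h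
sumBelow-+ zero    g h = refl
sumBelow-+ (suc n) g h rewrite sumBelow-+ n (g ∘ suc) (h ∘ suc) =
  interchange (g 0) (h 0) _ _
  where
  interchange : ∀ a b c d → a +ℕ b +ℕ (c +ℕ d) ≡ a +ℕ c +ℕ (b +ℕ d)
  interchange = solve-∀

sumBelow-0 : ∀ n → sumBelow n (const 0) ≡ 0
sumBelow-0 zero    = refl
sumBelow-0 (suc n) = sumBelow-0 n

sumBelow-1 : ∀ n → sumBelow n (const 1) ≡ n
sumBelow-1 zero    = refl
sumBelow-1 (suc n) = cong suc (sumBelow-1 n)

sumBelow-extend : ∀ {n k} g → n ≤ k → (∀ a → ¬ a < n → g a ≡ 0) → sumBelow n g ≡ sumBelow k g
sumBelow-extend {k = k} g z≤n h =
  sym (trans (sumBelow-cong k λ a _ → h a λ ()) (sumBelow-0 k))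
sumBelow-extend g (s≤s n≤k) h =
  cong (g 0 +ℕ_) (sumBelow-extend (g ∘ suc) n≤k λ a a≮n → h (suc a) (a≮n ∘ ℕ.s<s⁻¹))

𝟙 : Bool → ℕ
𝟙 x = if x then 1 else 0

sumBelow-last : ∀ n → sumBelow (suc n) (λ b → 𝟙 (b ≡ᵇ n)) ≡ 1
sumBelow-last zero    = refl
sumBelow-last (suc n) = sumBelow-last n

-- One count serves all three statistics: `Q` selects the diagonal, the marks or every cell. The
-- range `k` is the side of the box, so that a hook raises it by exactly one.
cellCount : ℕ → (ℕ → ℕ) → (ℕ → ℕ → Bool) → ℕ
cellCount k f Q = sumBelow k λ a → sumBelow (f a) λ b → 𝟙 (Q a b)

cellCount-cong : ∀ k {f g Q R} → f ≗ g → (∀ a b → Q a b ≡ R a b) →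
                 cellCount k f Q ≡ cellCount k g R
cellCount-cong k {f} {g} {Q} f≗g Q≗R = sumBelow-cong k λ a _ →
  trans (cong (λ n → sumBelow n (𝟙 ∘ Q a)) (f≗g a))
        (sumBelow-cong (g a) λ b _ → cong 𝟙 (Q≗R a b))

cellCount-extend : ∀ {n k f} Q → n ≤ k → (∀ a → ¬ a < n → f a ≡ 0) →
                   cellCount n f Q ≡ cellCount k f Q
cellCount-extend Q n≤k h =
  sumBelow-extend _ n≤k λ a a≮n → cong (λ m → sumBelow m (𝟙 ∘ Q a)) (h a a≮n)

-- The summands are the cell `(0 , 0)`, the rest of the first row, the rest of the first column, and
-- the interior shifted by one in each direction.
cellCount-hook : ∀ n f Q → cellCount (suc n) (hookRows n f) Q ≡
  𝟙 (Q 0 0) +ℕ sumBelow n (λ b → 𝟙 (Q 0 (suc b))) +ℕ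
  (sumBelow n (λ a → 𝟙 (Q (suc a) 0)) +ℕ cellCount n f (λ a b → Q (suc a) (suc b)))
cellCount-hook n f Q = cong (_ +ℕ_)
  (trans (sumBelow-cong n λ a a<n → cong (λ m → sumBelow m (𝟙 ∘ Q (suc a))) (hookRows-< f a<n))
         (sumBelow-+ n _ _))

module _ {P : Pred Cell 0ℓ} (P? : Decidable P) where

  private
    count : List Cell → ℕ
    count xs = length (filter P? xs)

    count-++ : ∀ xs ys → count (xs ++ ys) ≡ count xs +ℕ count ys
    count-++ xs ys = trans (cong length (List.filter-++ P? xs ys)) (List.length-++ (filter P? xs))

    Q : ℕ → ℕ → Bool
    Q a b = does (P? (a , b))

    -- The general `h` is for the induction, as `applyUpTo` recurses on `h ∘ suc`; `upTo` is the
    -- case `h = id`.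
    count-row : ∀ a h n → count (map (a ,_) (applyUpTo h n)) ≡ sumBelow n (λ b → 𝟙 (Q a (h b)))
    count-row a h zero    = refl
    count-row a h (suc n) with P? (a , h 0)
    ... | yes _ = cong suc (count-row a (h ∘ suc) n)
    ... | no  _ = count-row a (h ∘ suc) n

    count-rows : ∀ (f h : ℕ → ℕ) n → count (concat (map (λ i → map (i ,_) (upTo (f i))) (applyUpTo h n))) ≡
                 sumBelow n (λ a → sumBelow (f (h a)) (λ b → 𝟙 (Q (h a) b)))
    count-rows f h zero    = refl
    count-rows f h (suc n) =
      trans (count-++ (map (h 0 ,_) (upTo (f (h 0)))) _)
            (cong₂ _+ℕ_ (count-row (h 0) id (f (h 0))) (count-rows f (h ∘ suc) n))

  length-filter-cells : ∀ λ′ {k} → length (parts λ′) ≤ k →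
    length (filter P? (cells λ′)) ≡ cellCount k (rowLength (parts λ′)) Q
  length-filter-cells λ′ l≤k =
    trans (count-rows (rowLength xs) id (length xs))
          (cellCount-extend {f = rowLength xs} Q l≤k λ a a≮l → rowLength-length xs (ℕ.≮⇒≥ a≮l))
    where xs = parts λ′

-- Monomials

sgn : ℕ → ℤ
sgn n = -1ℤ ℤ.^ n

signedTerm : (d m s : ℕ) → Term
signedTerm d m s = term (sgn (d +ℕ ⌊ m /2⌋)) m s

signedTerm-cong : ∀ {d d′ m m′ s s′} → d ≡ d′ → m ≡ m′ → s ≡ s′ →
                  signedTerm d m s ≡ signedTerm d′ m′ s′
signedTerm-cong refl refl refl = refl

monomial : Overpartition → Term
monomial ν = signedTerm (diag ν) (mark ν) (size ν)

monomialₚ : ℕ → Profile → Term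
monomialₚ k P = signedTerm (cellCount k (rows P) _≡ᵇ_) (cellCount k (rows P) (marks P))
                           (cellCount k (rows P) λ _ _ → true)

monomialₚ-cong : ∀ k {P R} → P ≈ₚ R → monomialₚ k P ≡ monomialₚ k R
monomialₚ-cong k (r , m) = signedTerm-cong
  (cellCount-cong k r λ _ _ → refl) (cellCount-cong k r m) (cellCount-cong k r λ _ _ → refl)

monomialₚ-extend : ∀ {n P} → Valid n P → monomialₚ (suc n) P ≡ monomialₚ n P
monomialₚ-extend {n} {P} v = sym (signedTerm-cong
  (extend _≡ᵇ_) (extend (marks P)) (extend λ _ _ → true))
  where extend = λ Q → cellCount-extend Q (ℕ.n≤1+n n) (vanishing v)

monomial-profileOf : ∀ {k} ν → length (parts (shape ν)) ≤ k → monomial ν ≡ monomialₚ k (profileOf ν)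
monomial-profileOf ν l≤k = signedTerm-cong
  (length-filter-cells _ λ′ l≤k) (length-filter-cells _ λ′ l≤k)
  -- The size is the count for a predicate that holds of every cell.
  (trans (sym (cong length (List.filter-all (λ _ → T? true) (All.universal _ (cells λ′)))))
         (length-filter-cells _ λ′ l≤k))
  where λ′ = shape ν

monomial-cong : ∀ ν ρ → ν ≈ᵒ ρ → monomial ν ≡ monomial ρ
monomial-cong ν ρ e =
  trans (monomial-profileOf ν (ℕ.≤-reflexive (cong length (proj₁ e))))
        (trans (monomialₚ-cong (length (parts (shape ρ))) (profileOf-cong ν ρ e))
               (sym (monomial-profileOf ρ ℕ.≤-refl)))

monomial-overpartition : ∀ {k} (c : Code k) → monomial (overpartition c) ≡ monomialₚ k ⟦ c ⟧
monomial-overpartition {k} c =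
  trans (monomial-profileOf (overpartition c) (proj₁ (proj₂ (overpartition-SOP c))))
        (monomialₚ-cong k (profile-overpartition c))

-- A hook has `2n + 1` cells; the one on the diagonal gives the sign.
hookTerm : ℕ → Term
hookTerm n = term -1ℤ 0 (suc (n +ℕ n))

size-hook : ∀ n f → cellCount (suc n) (hookRows n f) (λ _ _ → true) ≡
            suc (n +ℕ n) +ℕ cellCount n f (λ _ _ → true)
size-hook n f =
  trans (cellCount-hook n f λ _ _ → true)
        (trans (cong (λ m → suc m +ℕ (m +ℕ s)) (sumBelow-1 n)) (sym (ℕ.+-assoc (suc n) n s)))
  where s = cellCount n f λ _ _ → true

diag-hook : ∀ n f → cellCount (suc n) (hookRows n f) _≡ᵇ_ ≡ suc (cellCount n f _≡ᵇ_)
diag-hook n f = trans (cellCount-hook n f _≡ᵇ_)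
  (cong (λ m → suc m +ℕ (m +ℕ cellCount n f _≡ᵇ_)) (sumBelow-0 n))

mark-hook-false : ∀ n P → cellCount (suc n) (hookRows n (rows P)) (hookMarks false n (marks P)) ≡
                  cellCount n (rows P) (marks P)
mark-hook-false n P = trans (cellCount-hook n (rows P) (hookMarks false n (marks P)))
  (cong (λ m → m +ℕ (m +ℕ cellCount n (rows P) (marks P))) (sumBelow-0 n))

-- With index `suc n` the two ends are distinct, so each arm contributes one mark.
mark-hook-true : ∀ n P → cellCount (2 +ℕ n) (hookRows (suc n) (rows P)) (hookMarks true (suc n) (marks P)) ≡
                 2 +ℕ cellCount (suc n) (rows P) (marks P)
mark-hook-true n P = trans (cellCount-hook (suc n) (rows P) (hookMarks true (suc n) (marks P)))
  (cong (λ m → m +ℕ (m +ℕ cellCount (suc n) (rows P) (marks P))) (sumBelow-last n))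

-- Two more marks give `t ^ 2` and raise `⌊ mark ν /2⌋` by one, hence the sign.
markTerm : Term
markTerm = term -1ℤ 2 0

monomialₚ-hook-false : ∀ n P → monomialₚ (suc n) (hook false n P) ≡ mulTerm (hookTerm n) (monomialₚ n P)
monomialₚ-hook-false n P =
  signedTerm-cong (diag-hook n (rows P)) (mark-hook-false n P) (size-hook n (rows P))

monomialₚ-hook-true : ∀ n P → monomialₚ (2 +ℕ n) (hook true (suc n) P) ≡
                      mulTerm markTerm (mulTerm (hookTerm (suc n)) (monomialₚ (suc n) P))
monomialₚ-hook-true n P =
  trans (signedTerm-cong (diag-hook (suc n) (rows P)) (mark-hook-true n P) (size-hook (suc n) (rows P)))
        (cong (λ e → term (-1ℤ ℤ.* sgn e) (2 +ℕ m) (suc (suc n +ℕ suc n) +ℕ cellCount (suc n) (rows P) λ _ _ → true))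
              (ℕ.+-suc (cellCount (suc n) (rows P) _≡ᵇ_) ⌊ m /2⌋))
  where m = cellCount (suc n) (rows P) (marks P)

-- Products of lists of terms

term-cong : ∀ {c d i k j l} → c ≡ d → i ≡ k → j ≡ l → term c i j ≡ term d k l
term-cong refl refl refl = refl

mulTerm-assoc : ∀ x y z → mulTerm (mulTerm x y) z ≡ mulTerm x (mulTerm y z)
mulTerm-assoc (term c i j) (term d k l) (term e m n) =
  term-cong (ℤ.*-assoc c d e) (ℕ.+-assoc i k m) (ℕ.+-assoc j l n)

mulTerm-comm : ∀ x y → mulTerm x y ≡ mulTerm y x
mulTerm-comm (term c i j) (term d k l) =
  term-cong (ℤ.*-comm c d) (ℕ.+-comm i k) (ℕ.+-comm j l)

mulTerm-identityˡ : ∀ x → mulTerm (term 1ℤ 0 0) x ≡ x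
mulTerm-identityˡ (term c i j) = cong (λ e → term e i j) (ℤ.*-identityˡ c)

mulTerm-swap : ∀ x y z → mulTerm x (mulTerm y z) ≡ mulTerm y (mulTerm x z)
mulTerm-swap x y z = trans (sym (mulTerm-assoc x y z))
  (trans (cong (λ w → mulTerm w z) (mulTerm-comm x y)) (mulTerm-assoc y x z))

-- A monomial factor moves through a product without reordering it, so this is an equality of lists.
*-map-mulTerm : ∀ h p r → p * map (mulTerm h) r ≡ map (mulTerm h) (p * r)
*-map-mulTerm h []      r = refl
*-map-mulTerm h (x ∷ p) r =
  trans (cong₂ _++_
           (trans (sym (List.map-∘ r)) (trans (List.map-cong (mulTerm-swap x h) r) (List.map-∘ r)))
           (*-map-mulTerm h p r))
        (sym (List.map-++ (mulTerm h) (map (mulTerm x) r) (p * r)))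

-- Products are grouped by the terms of the left factor, so the blocks from `r` and `s` alternate
-- and have to be sorted apart. In `gain-suc` no other step reorders terms.
*-distribˡ-++ : ∀ p r s → p * (r ++ s) ↭ p * r ++ p * s
*-distribˡ-++ []      r s = ↭-refl
*-distribˡ-++ (x ∷ p) r s = ↭-trans
  (↭.++⁺ (↭-reflexive (List.map-++ (mulTerm x) r s)) (*-distribˡ-++ p r s))
  (interchange (map (mulTerm x) r) (map (mulTerm x) s) (p * r) (p * s))
  where
  open CommutativeSemigroupProperties
    (CommutativeMonoid.commutativeSemigroup (↭.++-commutativeMonoid {A = Term}))
    using (interchange)

single-* : ∀ x r → (x ∷ []) * r ≡ map (mulTerm x) r
single-* x r = List.++-identityʳ _

-- Powers and summands as single terms

single-^ : ∀ c i j n → (term c i j ∷ []) ^ n ≡ term (c ℤ.^ n) (n ℕ.* i) (n ℕ.* j) ∷ []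
single-^ c i j zero    = refl
single-^ c i j (suc n) rewrite single-^ c i j n = refl

[-1]^ : ∀ n → (- 1#) ^ n ≡ term (sgn n) 0 0 ∷ []
[-1]^ n = trans (single-^ -1ℤ 0 0 n) (cong (λ i → term (sgn n) i i ∷ []) (ℕ.*-zeroʳ n))

t^ : ∀ n → t ^ n ≡ term 1ℤ n 0 ∷ []
t^ n = trans (single-^ 1ℤ 1 0 n)
  (cong (_∷ []) (term-cong (ℤ.^-zeroˡ n) (ℕ.*-identityʳ n) (ℕ.*-zeroʳ n)))

q^ : ∀ n → q ^ n ≡ term 1ℤ 0 n ∷ []
q^ n = trans (single-^ 1ℤ 0 1 n)
  (cong (_∷ []) (term-cong (ℤ.^-zeroˡ n) (ℕ.*-zeroʳ n) (ℕ.*-identityʳ n)))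

[-q]^ : ∀ n → (- q) ^ n ≡ term (sgn n) 0 n ∷ []
[-q]^ n = trans (single-^ -1ℤ 0 1 n)
  (cong (_∷ []) (term-cong refl (ℕ.*-zeroʳ n) (ℕ.*-identityʳ n)))

weight : Overpartition → Polynomial
weight ν = (- 1#) ^ (diag ν +ℕ ⌊ mark ν /2⌋) * t ^ mark ν * q ^ size ν

weight≡monomial : ∀ ν → weight ν ≡ monomial ν ∷ []
weight≡monomial ν
  rewrite [-1]^ (diag ν +ℕ ⌊ mark ν /2⌋) | t^ (mark ν) | q^ (size ν) =
  cong (_∷ []) (term-cong
    (trans (ℤ.*-identityʳ _) (ℤ.*-identityʳ _)) (ℕ.+-identityʳ _) refl)

∑-weight : ∀ νs → (∑[ ν ∈ νs ] weight ν) ≡ map monomial νs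
∑-weight []       = refl
∑-weight (ν ∷ νs) = cong₂ _++_ (weight≡monomial ν) (∑-weight νs)

-- The recurrence, hook by hook

sgn-double : ∀ n → sgn (n +ℕ n) ≡ 1ℤ
sgn-double zero    = refl
sgn-double (suc n) rewrite ℕ.+-suc n n | sgn-double n = refl

-- The hook size is odd, so its power of `- q` has the same sign as one diagonal cell.
[-q]^-hook : ∀ k e → (- q) ^ (suc (k +ℕ k) +ℕ e) ≡ map (mulTerm (hookTerm k)) ((- q) ^ e)
[-q]^-hook k e = trans ([-q]^ (suc (k +ℕ k) +ℕ e))
  (trans (cong (_∷ []) (term-cong scalar refl refl)) (cong (map (mulTerm (hookTerm k))) (sym ([-q]^ e))))
  where
  scalar : sgn (suc (k +ℕ k) +ℕ e) ≡ -1ℤ ℤ.* sgn e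
  scalar = cong (-1ℤ ℤ.*_) (trans (ℤ.^-distribˡ-+-* -1ℤ (k +ℕ k) e)
    (trans (cong (ℤ._* sgn e) (sgn-double k)) (ℤ.*-identityˡ (sgn e))))

suc-square : ∀ k → suc k ℕ.* suc k ≡ suc (k +ℕ k) +ℕ k ℕ.* k
suc-square = solve-∀

map-single-* : ∀ h x r → map (mulTerm h) (x ∷ []) * r ≡ map (mulTerm h) ((x ∷ []) * r)
map-single-* h x r = trans (single-* (mulTerm h x) r)
  (trans (List.map-cong (mulTerm-assoc h x) r)
    (trans (List.map-∘ r) (cong (map (mulTerm h)) (sym (single-* x r)))))

[-q]^-hook-* : ∀ k {i} → i ≤ k → ∀ r → (- q) ^ (suc k ℕ.* suc k ∸ i ℕ.* i) * r ≡
               map (mulTerm (hookTerm k)) ((- q) ^ (k ℕ.* k ∸ i ℕ.* i) * r)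
[-q]^-hook-* k {i} i≤k r =
  -- Since `i ≤ k`, the truncated subtraction is exact and the hook size can be taken out of it.
  trans (cong (λ e → (- q) ^ e * r) (trans (cong (_∸ i ℕ.* i) (suc-square k))
           (ℕ.+-∸-assoc (suc (k +ℕ k)) (ℕ.*-mono-≤ i≤k i≤k))))
  (trans (cong (_* r) ([-q]^-hook k e))
  (subst (λ x → map (mulTerm (hookTerm k)) x * r ≡ map (mulTerm (hookTerm k)) (x * r))
         (sym ([-q]^ e)) (map-single-* (hookTerm k) (term (sgn e) 0 e) r)))
  where e = k ℕ.* k ∸ i ℕ.* i

partialSum-hook : ∀ k i → i ≤ k → partialSum (suc k) i ≡ map (mulTerm (hookTerm k)) (partialSum k i)
partialSum-hook k zero    _   = refl
partialSum-hook k (suc i) i<k =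
  trans (cong₂ _++_ (partialSum-hook k i (ℕ.<⇒≤ i<k)) ([-q]^-hook-* k i<k T[ i ]))
        (sym (List.map-++ _ (partialSum k i) _))

-- What the recurrence adds to `T[ n ]`; it is matched with the overpartitions whose first row has
-- length `suc n`.
gain : ℕ → Polynomial
gain n = (1# + t) * (- q) ^ (suc n ℕ.* suc n) + (1# - t ^ 2) * partialSum (suc n) n

T-suc : ∀ n → T[ suc n ] ≡ T[ n ] ++ gain n
T-suc n = List.++-assoc T[ n ] _ _

1-t² : ∀ r → (1# - t ^ 2) * r ≡ r ++ map (mulTerm markTerm) r
1-t² r = cong₂ _++_ (trans (List.map-cong mulTerm-identityˡ r) (List.map-id r)) (single-* markTerm r)

-- All earlier summands acquire the factor `hookTerm (suc n)`, and the one new summand of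
-- `partialSum` is that factor times `T[ n ]`. The three blocks correspond to `outer`, `inner false`
-- and `inner true`.
gain-suc : ∀ n → let h = map (mulTerm (hookTerm (suc n))) in
           gain (suc n) ↭ h (gain n) ++ h T[ n ] ++ map (mulTerm markTerm) (h T[ n ])
gain-suc n = begin
  A′ ++ B * partialSum (suc k) k
    ≡⟨ cong₂ (λ x y → x ++ B * y) A′≡ S≡ ⟩
  h A ++ B * (h S ++ h T[ n ])
    ↭⟨ ↭.++⁺ˡ (h A) (*-distribˡ-++ B (h S) (h T[ n ])) ⟩
  h A ++ B * h S ++ B * h T[ n ]
    ≡⟨ cong₂ (λ x y → h A ++ x ++ y) (*-map-mulTerm (hookTerm k) B S) (1-t² (h T[ n ])) ⟩
  h A ++ h (B * S) ++ R
    ≡⟨ List.++-assoc (h A) (h (B * S)) R ⟨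
  (h A ++ h (B * S)) ++ R
    ≡⟨ cong (_++ R) (List.map-++ (mulTerm (hookTerm k)) A (B * S)) ⟨
  h (gain n) ++ R ∎
  where
  open ↭.PermutationReasoning
  k  = suc n
  h  = map (mulTerm (hookTerm k))
  A′ = (1# + t) * (- q) ^ (suc k ℕ.* suc k)
  A  = (1# + t) * (- q) ^ (k ℕ.* k)
  B  = 1# - t ^ 2
  S  = partialSum k n
  R  = h T[ n ] ++ map (mulTerm markTerm) (h T[ n ])

  A′≡ : A′ ≡ h A
  A′≡ = trans (cong ((1# + t) *_) (trans (cong ((- q) ^_) (suc-square k)) ([-q]^-hook k (k ℕ.* k))))
              (*-map-mulTerm (hookTerm k) (1# + t) ((- q) ^ (k ℕ.* k)))

  S≡ : partialSum (suc k) k ≡ h S ++ h T[ n ]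
  S≡ = cong₂ _++_ (partialSum-hook k n (ℕ.n≤1+n n))
    (trans ([-q]^-hook-* k ℕ.≤-refl T[ n ])
      -- In the new summand the index equals `k`, so beyond the hook only `(- q) ^ 0` is left.
      (cong h (trans (cong (λ e → (- q) ^ e * T[ n ]) (ℕ.n∸n≡0 (k ℕ.* k)))
        (trans (single-* (term 1ℤ 0 0) T[ n ]) (trans (List.map-cong mulTerm-identityˡ T[ n ]) (List.map-id T[ n ]))))))

-- Matching the recurrence with the codes

map-square : ∀ {A B C D : Set} {f : B → D} {g : A → B} {h : C → D} {i : A → C} →
             (∀ x → f (g x) ≡ h (i x)) → ∀ xs → map f (map g xs) ≡ map h (map i xs)
map-square e xs = trans (sym (List.map-∘ xs)) (trans (List.map-cong e xs) (List.map-∘ xs))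

codeMonomial : ∀ {k} → Code k → Term
codeMonomial {k} c = monomialₚ k ⟦ c ⟧

fullMonomial : ∀ {k} → Full k → Term
fullMonomial {k} c = monomialₚ k ⟦ c ⟧ᶠ

fullMonomial-outer : ∀ {n} (c : Full n) → mulTerm (hookTerm n) (fullMonomial c) ≡ fullMonomial (outer c)
fullMonomial-outer {n} c = sym (monomialₚ-hook-false n ⟦ c ⟧ᶠ)

fullMonomial-inner-false : ∀ {n} (c : Code n) →
  mulTerm (hookTerm (suc n)) (codeMonomial c) ≡ fullMonomial (inner false c)
fullMonomial-inner-false {n} c =
  -- The code lives in the box of side `n`, while a hook of index `suc n` surrounds a box of side
  -- `suc n`; the extra row is empty.
  trans (cong (mulTerm (hookTerm (suc n))) (sym (monomialₚ-extend (⟦⟧-valid c))))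
        (sym (monomialₚ-hook-false (suc n) ⟦ c ⟧))

fullMonomial-inner-true : ∀ {n} (c : Code n) →
  mulTerm markTerm (mulTerm (hookTerm (suc n)) (codeMonomial c)) ≡ fullMonomial (inner true c)
fullMonomial-inner-true {n} c =
  trans (cong (mulTerm markTerm ∘ mulTerm (hookTerm (suc n))) (sym (monomialₚ-extend (⟦⟧-valid c))))
        (sym (monomialₚ-hook-true n ⟦ c ⟧))

mutual
  T↭codes : ∀ k → T[ k ] ↭ map codeMonomial (codes k)
  T↭codes zero    = ↭-refl
  T↭codes (suc n) = begin
    T[ suc n ]
      ≡⟨ T-suc n ⟩
    T[ n ] ++ gain n
      ↭⟨ ↭.++⁺ (T↭codes n) (gain↭fulls n) ⟩
    map codeMonomial (codes n) ++ map fullMonomial (fulls (suc n))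
      ≡⟨ cong₂ _++_ (trans (List.map-cong (sym ∘ monomialₚ-extend ∘ ⟦⟧-valid) (codes n)) (List.map-∘ (codes n)))
                    (List.map-∘ (fulls (suc n))) ⟩
    map codeMonomial (map widen (codes n)) ++ map codeMonomial (map full (fulls (suc n)))
      ≡⟨ List.map-++ codeMonomial (map widen (codes n)) _ ⟨
    map codeMonomial (codes (suc n)) ∎
    where open ↭.PermutationReasoning

  gain↭fulls : ∀ n → gain n ↭ map fullMonomial (fulls (suc n))
  -- Both sides compute to the two terms of `(1# + t) * (- q)`: a hook of one cell has one end, and
  -- a single mark leaves the sign unchanged.
  gain↭fulls zero    = ↭-refl
  gain↭fulls (suc n) = begin
    gain (suc n)
      ↭⟨ gain-suc n ⟩
    h (gain n) ++ h T[ n ] ++ m (h T[ n ])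
      ↭⟨ ↭.++⁺ (↭.map⁺ _ (gain↭fulls n))
               (↭.++⁺ (↭.map⁺ _ (T↭codes n)) (↭.map⁺ _ (↭.map⁺ _ (T↭codes n)))) ⟩
    h (map fullMonomial fs) ++ h (map codeMonomial cs) ++ m (h (map codeMonomial cs))
      ≡⟨ cong₂ _++_ (map-square fullMonomial-outer fs) (cong₂ _++_
           (map-square fullMonomial-inner-false cs)
           (trans (sym (List.map-∘ (map codeMonomial cs))) (map-square fullMonomial-inner-true cs))) ⟩
    map fullMonomial (map outer fs) ++ map fullMonomial (map (inner false) cs) ++ map fullMonomial (map (inner true) cs)
      ≡⟨ cong (map fullMonomial (map outer fs) ++_) (List.map-++ fullMonomial (map (inner false) cs) _) ⟨
    map fullMonomial (map outer fs) ++ map fullMonomial (map (inner false) cs ++ map (inner true) cs)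
      ≡⟨ List.map-++ fullMonomial (map outer fs) _ ⟨
    map fullMonomial (fulls (2 +ℕ n)) ∎
    where
    open ↭.PermutationReasoning
    h  = map (mulTerm (hookTerm (suc n)))
    m  = map (mulTerm markTerm)
    fs = fulls (suc n)
    cs = codes n

-- Enumerations

module _ {a ℓ} (S : Setoid a ℓ) where

  open Setoid S using () renaming (_≈_ to _≈ₛ_; refl to ≈-refl; sym to ≈-sym)
  open SetoidMembership S using () renaming (_∈_ to _∈ₛ_)
  open SetoidUnique S using () renaming (Unique to Uniqueₛ)
  open SetoidPermutation S using () renaming (_↭_ to _↭ₛ_; ↭-trans to ↭ₛ-trans; ↭-sym to ↭ₛ-sym; ↭-prep to ↭ₛ-prep; ↭-reflexive-≋ to ↭ₛ-pointwise)

  ∈⇒↭∷ : ∀ {x} ys → x ∈ₛ ys → ∃ λ zs → ys ↭ₛ x ∷ zs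
  ∈⇒↭∷ ys x∈ys =
    let as , bs , w , x≈w , ys≋ = SetoidMembershipProperties.∈-∃++ S x∈ys
    in as ++ bs , ↭ₛ-trans (↭ₛ-pointwise ys≋) (SetoidPermutationProperties.shift S (≈-sym x≈w) as bs)

  -- The head of `xs` is brought to the front of `ys`. By uniqueness it occurs in neither remainder,
  -- so the remainders again have the same members.
  unique∧⇔⇒↭ : ∀ {xs ys} → Uniqueₛ xs → Uniqueₛ ys →
               (∀ z → z ∈ₛ xs → z ∈ₛ ys) → (∀ z → z ∈ₛ ys → z ∈ₛ xs) → xs ↭ₛ ys
  unique∧⇔⇒↭ {[]}     {[]}     _ _ _ _ = SetoidPermutation.↭-refl S
  unique∧⇔⇒↭ {[]}     {y ∷ ys} _ _ _ ⊇ = case ⊇ y (here ≈-refl) of λ ()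
  unique∧⇔⇒↭ {x ∷ xs} {ys} (x∉xs ∷ xs!) ys! ⊆ ⊇
    with zs , ys↭ ← ∈⇒↭∷ ys (⊆ x (here ≈-refl))
    with x∉zs ∷ zs! ← SetoidPermutationProperties.Unique-resp-↭ S ys↭ ys! =
    ↭ₛ-trans (↭ₛ-prep x (unique∧⇔⇒↭ xs! zs!
      (λ z z∈xs → drop x∉xs z∈xs (SetoidPermutationProperties.∈-resp-↭ S ys↭ (⊆ z (there z∈xs))))
      (λ z z∈zs → drop x∉zs z∈zs (⊇ z (SetoidPermutationProperties.∈-resp-↭ S (↭ₛ-sym ys↭) (there z∈zs))))))
      (↭ₛ-sym ys↭)
    where
    drop : ∀ {us vs z} → All (λ u → ¬ x ≈ₛ u) us → z ∈ₛ us → z ∈ₛ x ∷ vs → z ∈ₛ vs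
    drop x∉us z∈us (here z≈x)   = contradiction
      (SetoidMembershipProperties.∈-resp-≈ S z≈x z∈us) (SetoidMembershipProperties.All[≉]⇒∉ S x∉us)
    drop x∉us z∈us (there z∈vs) = z∈vs

-- Makes the sum independent of the enumeration, so that `sops k` can stand for any other.
enumerations-↭ : ∀ {P νs ρs} → νs Enumerates P → ρs Enumerates P →
                 map monomial νs ↭ map monomial ρs
enumerations-↭ {νs = νs} {ρs} e f = ↭ₛ⇒↭
  (SetoidPermutationProperties.map⁺ overpartitionSetoid (setoid Term) (λ {ν} {ρ} → monomial-cong ν ρ)
    (unique∧⇔⇒↭ overpartitionSetoid (unique e) (unique f)
      (λ ν → from (member f ν) ∘ to (member e ν))
      (λ ν → from (member e ν) ∘ to (member f ν))))
  where
  open _Enumerates_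
  open Equivalence

-- Coefficients under permutation of terms

termCoeff : Term → ℕ → ℕ → ℤ
termCoeff (term c i j) a b = if does (i ≟ a) ∧ does (j ≟ b) then c else 0ℤ

coeff-resp-↭ : ∀ {p r} → p ↭ r → p ≈ r
coeff-resp-↭ ↭.refl         a b = refl
coeff-resp-↭ (↭.prep x p↭r) a b = cong (ℤ._+_ (termCoeff x a b)) (coeff-resp-↭ p↭r a b)
coeff-resp-↭ (↭.swap {p} {r} x y p↭r) a b = begin
  x′ ℤ.+ (y′ ℤ.+ coeff p a b) ≡⟨ cong (λ z → x′ ℤ.+ (y′ ℤ.+ z)) (coeff-resp-↭ p↭r a b) ⟩
  x′ ℤ.+ (y′ ℤ.+ coeff r a b) ≡⟨ ℤ.+-assoc x′ y′ _ ⟨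
  x′ ℤ.+ y′ ℤ.+ coeff r a b   ≡⟨ cong (ℤ._+ coeff r a b) (ℤ.+-comm x′ y′) ⟩
  y′ ℤ.+ x′ ℤ.+ coeff r a b   ≡⟨ ℤ.+-assoc y′ x′ _ ⟩
  y′ ℤ.+ (x′ ℤ.+ coeff r a b) ∎
  where
  open ≡-Reasoning
  x′ = termCoeff x a b
  y′ = termCoeff y a b
coeff-resp-↭ (↭.trans p↭r r↭s) a b = trans (coeff-resp-↭ p↭r a b) (coeff-resp-↭ r↭s a b)

theorem4p1 : (k : ℕ) →
    (∃ λ (νs : List Overpartition) → νs Enumerates SOP k)
    × ((νs : List Overpartition) → νs Enumerates SOP k →
    T[ k ] ≈ (∑[ ν ∈ νs ] (- 1#) ^ (diag ν +ℕ ⌊ mark ν /2⌋) * t ^ mark ν * q ^ size ν))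
theorem4p1 k = (sops k , sops-enumerates k) , λ νs e → coeff-resp-↭ (begin
  T[ k ]
    ↭⟨ T↭codes k ⟩
  map codeMonomial (codes k)
    ≡⟨ trans (List.map-cong (sym ∘ monomial-overpartition) (codes k)) (List.map-∘ (codes k)) ⟩
  map monomial (sops k)
    ↭⟨ enumerations-↭ (sops-enumerates k) e ⟩
  map monomial νs
    ≡⟨ ∑-weight νs ⟨
  ∑ νs weight ∎)
  where open ↭.PermutationReasoning
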